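{- Let $A,B\in\mathbb{Q}$ with $AB\neq 0$. The trinomial $x^4+Ax^2+B$ has reducibility type $(1,1,2)$ if and only if, up to scaling, $(A,B)=(q-1,-q)$ for some $q\in\mathbb{Q}\setminus\{1\}$ such that $-q$ is not the square of a rational number, with factorization $$x^4+Ax^2+B=(x-1)(x+1)(x^2+q);$$ and it has reducibility type $(1,1,1,1)$ if and only if, up to scaling, $(A,B)=(-u^2-1,u^2)$ for some $u\in\mathbb{Q}\setminus\{0\}$, with factorization $$x^4+Ax^2+B=(x-1)(x+1)(x-u)(x+u).$$
   Context: A monic polynomial in $\mathbb{Q}[x]$ has reducibility type $(n_1,\dots,n_k)$, $n_1\le\dots\le n_k$, if it factors as a product of $k$ irreducible polynomials in $\mathbb{Q}[x]$ (not necessarily distinct) of degrees $n_1,\dots,n_k$. Trinomials are considered up to scaling: $x^n+Ax^m+B$ and $x^n+A\lambda^{n-m}x^m+B\lambda^n$ are identified for $\lambda\in\mathbb{Q}\setminus\{0\}$; "up to scaling $(A,B)=(A_0,B_0)$" means $(A,B)=(A_0\lambda^{n-m},B_0\lambda^n)$ for some $\lambda\in\mathbb{Q}\setminus\{0\}$ (and the factorization is that of the scaled trinomial). -}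

module Defs where

open import Algebra.Bundles.Raw using (RawRing)
open import Data.List.Base using (List; []; _∷_; [_]; map; foldr)
open import Data.List.Relation.Binary.Pointwise.Base using (Pointwise)
open import Data.List.Relation.Unary.All using (All)
open import Data.List.Relation.Unary.Linked using (Linked)
open import Data.Nat.Base as ℕ using (ℕ; zero; suc)
open import Data.Product.Base using (_×_; ∃-syntax)
open import Data.Rational.Base as ℚ using (ℚ; 0ℚ; 1ℚ)
open import Level using (0ℓ)
open import Relation.Binary.PropositionalEquality.Core using (_≡_; _≢_)

open import Algebra.Definitions.RawSemiring ℚ.+-*-rawSemiring public
  using (_^_)

IsSquare : ℚ → Set
IsSquare r = ∃[ s ] r ≡ s ^ 2

-- A polynomial is its list of coefficients, constant term first.  Trailing
-- zeros are allowed, so equality of polynomials is _≈ₚ_, not _≡_.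

Poly : Set
Poly = List ℚ

coeff : Poly → ℕ → ℚ
coeff []      _       = 0ℚ
coeff (a ∷ p) zero    = a
coeff (a ∷ p) (suc k) = coeff p k

infix 4 _≈ₚ_

record _≈ₚ_ (p q : Poly) : Set where
  constructor mk≈
  field coeff-≡ : ∀ k → coeff p k ≡ coeff q k

const : ℚ → Poly
const a = [ a ]

X : Poly
X = 0ℚ ∷ 1ℚ ∷ []

infix  8 -ₚ_
infixl 7 _*ₚ_
infixl 6 _+ₚ_ _-ₚ_

_+ₚ_ : Poly → Poly → Poly
[]      +ₚ q       = q
(a ∷ p) +ₚ []      = a ∷ p
(a ∷ p) +ₚ (b ∷ q) = (a ℚ.+ b) ∷ (p +ₚ q)

-ₚ_ : Poly → Poly
-ₚ_ = map (λ a → ℚ.- a)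

_-ₚ_ : Poly → Poly → Poly
p -ₚ q = p +ₚ (-ₚ q)

-- (a + x p) q = a q + x (p q)
_*ₚ_ : Poly → Poly → Poly
[]      *ₚ q = []
(a ∷ p) *ₚ q = map (a ℚ.*_) q +ₚ (0ℚ ∷ (p *ₚ q))

ℚ[x] : RawRing 0ℓ 0ℓ
ℚ[x] = record
  { Carrier = Poly
  ; _≈_     = _≈ₚ_
  ; _+_     = _+ₚ_
  ; _*_     = _*ₚ_
  ; -_      = -ₚ_
  ; 0#      = []
  ; 1#      = const 1ℚ
  }

open import Algebra.Definitions.RawSemiring (RawRing.rawSemiring ℚ[x]) public
  using (Irreducible)
  renaming (_^_ to _^ₚ_)

productₚ : List Poly → Poly
productₚ = foldr _*ₚ_ (const 1ℚ)

HasDegree : Poly → ℕ → Set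
HasDegree p n = coeff p n ≢ 0ℚ × (∀ k → n ℕ.< k → coeff p k ≡ 0ℚ)

Monic : Poly → Set
Monic p = ∃[ n ] (HasDegree p n × coeff p n ≡ 1ℚ)

record IrreducibleFactorization (p : Poly) (ns : List ℕ) (fs : List Poly) : Set where
  field
    irreducible : All Irreducible fs
    degrees     : Pointwise HasDegree fs ns
    factors     : p ≈ₚ productₚ fs

record HasReducibilityType (p : Poly) (ns : List ℕ) : Set where
  field
    monic         : Monic p
    nondecreasing : Linked ℕ._≤_ ns
    factorization : ∃[ fs ] IrreducibleFactorization p ns fs

trinomial : (n m : ℕ) → ℚ → ℚ → Poly
trinomial n m A B = X ^ₚ n +ₚ const A *ₚ X ^ₚ m +ₚ const B

-- Up to scaling, (A , B) = (A₀ , B₀); meant for exponents n ≥ m.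
UpToScaling : (n m : ℕ) → (A B A₀ B₀ : ℚ) → Set
UpToScaling n m A B A₀ B₀ =
  ∃[ t ] (t ≢ 0ℚ × A ≡ A₀ ℚ.* t ^ (n ℕ.∸ m) × B ≡ B₀ ℚ.* t ^ n)

{-# OPTIONS --safe #-}
-- If (x + α)(x + β)(x² + bx + c) is an even quartic, then comparing the
-- coefficients of x³ and x gives b = -(α + β) and (α + β)(c - αβ) = 0.  So either
-- β = -α, and the polynomial is (x² - α²)(x² + c), or c = αβ and the quadratic
-- factor splits as (x - α)(x - β).  In both cases α is a scaling factor which
-- moves the roots ±α to ±1.
module Submission where

open import Defs
open import Algebra.Apartness.Properties.HeytingCommutativeRing using (x#0y#0→xy#0)
open import Algebra.Bundles.Raw using (RawRing)
open import Algebra.Definitions.RawMagma using (_,_)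
open import Algebra.Definitions.RawSemiring using (mkIrred)
open import Data.List.Base using (List; []; _∷_; map)
open import Data.List.Relation.Binary.Pointwise.Base using ([]; _∷_)
open import Data.List.Relation.Unary.All using ([]; _∷_)
open import Data.List.Relation.Unary.Linked using ([-]; _∷_)
open import Data.Nat.Base as ℕ using (ℕ; zero; suc; s≤s; z≤n)
open import Data.Nat.Properties as ℕ using (<-cmp)
open import Data.Product.Base using (_×_; ∃-syntax; _,_; proj₁; proj₂)
open import Data.Rational.Base using (ℚ; 0ℚ; 1ℚ; _*_; _-_; -_; _+_; 1/_; ≢-nonZero)
open import Data.Rational.Properties
  using (_≟_; +-*-commutativeRing; heytingCommutativeRing; *-inverseˡ;
         +-identityʳ; *-identityʳ; *-zeroˡ; *-zeroʳ)
open import Data.Sum.Base using (_⊎_; inj₁; inj₂; [_,_]; map₂) renaming (map to map⊎)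
open import Function.Bundles using (_⇔_; mk⇔)
open import Level using (0ℓ)
open import Relation.Binary.Definitions using (tri<; tri≈; tri>)
open import Relation.Binary.PropositionalEquality.Core
  using (_≡_; _≢_; refl; sym; trans; cong; cong₂; subst)
open import Relation.Binary.PropositionalEquality.Properties using (module ≡-Reasoning)
open import Relation.Nullary.Decidable using (yes; no; dec⇒maybe)
open import Relation.Nullary.Negation.Core using (¬_; contradiction)
open import Tactic.RingSolver using (solve-∀)
open import Tactic.RingSolver.Core.AlmostCommutativeRing
  using (AlmostCommutativeRing; fromCommutativeRing)

open import Algebra.Definitions.RawSemiring (RawRing.rawSemiring ℚ[x]) using (_∣_; _∤_)
open _≈ₚ_
open ≡-Reasoning

-- Arithmetic in ℚ

ℚ-ring : AlmostCommutativeRing 0ℓ 0ℓ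
ℚ-ring = fromCommutativeRing +-*-commutativeRing (λ x → dec⇒maybe (0ℚ ≟ x))

-- The apartness of the Heyting commutative ring ℚ is `_≢_` itself, so the general law for apartness
-- applies as it stands.
*-≢0 : ∀ {x y} → x ≢ 0ℚ → y ≢ 0ℚ → x * y ≢ 0ℚ
*-≢0 = x#0y#0→xy#0 heytingCommutativeRing

x*y≡0⇒x≡0∨y≡0 : ∀ {x y} → x * y ≡ 0ℚ → x ≡ 0ℚ ⊎ y ≡ 0ℚ
x*y≡0⇒x≡0∨y≡0 {x} {y} xy≡0 with x ≟ 0ℚ | y ≟ 0ℚ
... | yes x≡0 | _       = inj₁ x≡0
... | no _    | yes y≡0 = inj₂ y≡0
... | no x≢0  | no y≢0  = contradiction xy≡0 (*-≢0 x≢0 y≢0)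

inverse : ∀ {x} → x ≢ 0ℚ → ∃[ y ] y * x ≡ 1ℚ
inverse {x} x≢0 = 1/ x , *-inverseˡ x
  where instance _ = ≢-nonZero x≢0

quotient : ∀ {x} → x ≢ 0ℚ → ∀ z → ∃[ y ] z ≡ y * x
quotient {x} x≢0 z with y , yx≡1 ← inverse x≢0 = z * y , (begin
  z            ≡⟨ *-identityʳ z ⟨
  z * 1ℚ       ≡⟨ cong (z *_) yx≡1 ⟨
  z * (y * x)  ≡⟨ assoc z y x ⟩
  z * y * x    ∎)
  where
  assoc : ∀ z y x → z * (y * x) ≡ z * y * x
  assoc = solve-∀ ℚ-ring

*-cancelʳ : ∀ {x y z} → z ≢ 0ℚ → x * z ≡ y * z → x ≡ y
*-cancelʳ {x} {y} {z} z≢0 xz≡yz with i , iz≡1 ← inverse z≢0 = begin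
  x            ≡⟨ undo x ⟨
  i * (x * z)  ≡⟨ cong (i *_) xz≡yz ⟩
  i * (y * z)  ≡⟨ undo y ⟩
  y            ∎
  where
  swap : ∀ i x z → i * (x * z) ≡ x * (i * z)
  swap = solve-∀ ℚ-ring
  undo : ∀ w → i * (w * z) ≡ w
  undo w = trans (swap i w z) (trans (cong (w *_) iz≡1) (*-identityʳ w))

-- Coefficients of products

coeff-+ : ∀ p q k → coeff (p +ₚ q) k ≡ coeff p k + coeff q k
coeff-+ []      q       k       = zeroˡ (coeff q k)
  where
  zeroˡ : ∀ x → x ≡ 0ℚ + x
  zeroˡ = solve-∀ ℚ-ring
coeff-+ (a ∷ p) []      k       = sym (+-identityʳ _)
coeff-+ (a ∷ p) (b ∷ q) zero    = refl
coeff-+ (a ∷ p) (b ∷ q) (suc k) = coeff-+ p q k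

coeff-scale : ∀ a p k → coeff (map (a *_) p) k ≡ a * coeff p k
coeff-scale a []      k       = sym (*-zeroʳ a)
coeff-scale a (b ∷ p) zero    = refl
coeff-scale a (b ∷ p) (suc k) = coeff-scale a p k

-- One step of the recursion in `_*ₚ_`, seen coefficientwise, for use in inductions on the left
-- factor.
coeff-∷* : ∀ a p q k → coeff ((a ∷ p) *ₚ q) k ≡ a * coeff q k + coeff (0ℚ ∷ (p *ₚ q)) k
coeff-∷* a p q k = trans (coeff-+ (map (a *_) q) _ k)
                         (cong (_+ coeff (0ℚ ∷ (p *ₚ q)) k) (coeff-scale a q k))

-- Zero may be represented by a nonempty list of zeros, so computation alone does not settle this.
*-zero-coeffs : ∀ p q → (∀ k → coeff p k ≡ 0ℚ) → ∀ k → coeff (p *ₚ q) k ≡ 0ℚ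
*-zero-coeffs []      q p≈0 k = refl
*-zero-coeffs (a ∷ p) q p≈0 k = begin
  coeff ((a ∷ p) *ₚ q) k                     ≡⟨ coeff-∷* a p q k ⟩
  a * coeff q k + coeff (0ℚ ∷ (p *ₚ q)) k    ≡⟨ cong₂ (λ x y → x * coeff q k + y) (p≈0 0) (shift k) ⟩
  0ℚ * coeff q k + 0ℚ                        ≡⟨ +-identityʳ _ ⟩
  0ℚ * coeff q k                             ≡⟨ *-zeroˡ (coeff q k) ⟩
  0ℚ                                         ∎
  where
  shift : ∀ k → coeff (0ℚ ∷ (p *ₚ q)) k ≡ 0ℚ
  shift zero    = refl
  shift (suc k) = *-zero-coeffs p q (λ j → p≈0 (suc j)) k

-- As `_*ₚ_` recurses on its left factor only, a zero right factor needs an induction of its own.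
*-zero-coeffsʳ : ∀ p q → (∀ k → coeff q k ≡ 0ℚ) → ∀ k → coeff (p *ₚ q) k ≡ 0ℚ
*-zero-coeffsʳ []      q q≈0 k = refl
*-zero-coeffsʳ (a ∷ p) q q≈0 k = begin
  coeff ((a ∷ p) *ₚ q) k                     ≡⟨ coeff-∷* a p q k ⟩
  a * coeff q k + coeff (0ℚ ∷ (p *ₚ q)) k    ≡⟨ cong₂ (λ x y → a * x + y) (q≈0 k) (shift k) ⟩
  a * 0ℚ + 0ℚ                                ≡⟨ +-identityʳ _ ⟩
  a * 0ℚ                                     ≡⟨ *-zeroʳ a ⟩
  0ℚ                                         ∎
  where
  shift : ∀ k → coeff (0ℚ ∷ (p *ₚ q)) k ≡ 0ℚ
  shift zero    = refl
  shift (suc k) = *-zero-coeffsʳ p q q≈0 k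

*ₚ-congˡ : ∀ p {q r} → q ≈ₚ r → p *ₚ q ≈ₚ p *ₚ r
*ₚ-congˡ []      q≈r = mk≈ λ _ → refl
*ₚ-congˡ (a ∷ p) {q} {r} q≈r = mk≈ λ k → begin
  coeff ((a ∷ p) *ₚ q) k                   ≡⟨ coeff-∷* a p q k ⟩
  a * coeff q k + coeff (0ℚ ∷ (p *ₚ q)) k  ≡⟨ cong₂ (λ x y → a * x + y) (coeff-≡ q≈r k) (shift k) ⟩
  a * coeff r k + coeff (0ℚ ∷ (p *ₚ r)) k  ≡⟨ coeff-∷* a p r k ⟨
  coeff ((a ∷ p) *ₚ r) k                   ∎
  where
  shift : ∀ k → coeff (0ℚ ∷ (p *ₚ q)) k ≡ coeff (0ℚ ∷ (p *ₚ r)) k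
  shift zero    = refl
  shift (suc k) = coeff-≡ (*ₚ-congˡ p q≈r) k

-- Removes the `const 1ℚ` with which `productₚ` closes every product.
*ₚ-identityʳ : ∀ p → p *ₚ const 1ℚ ≈ₚ p
*ₚ-identityʳ []      = mk≈ λ _ → refl
*ₚ-identityʳ (a ∷ p) = mk≈ λ { zero → head a ; (suc k) → coeff-≡ (*ₚ-identityʳ p) k }
  where
  head : ∀ a → a * 1ℚ + 0ℚ ≡ a
  head = solve-∀ ℚ-ring

≈ₚ-trans : ∀ {p q r} → p ≈ₚ q → q ≈ₚ r → p ≈ₚ r
≈ₚ-trans p≈q q≈r = mk≈ λ k → trans (coeff-≡ p≈q k) (coeff-≡ q≈r k)

≈ₚ-sym : ∀ {p q} → p ≈ₚ q → q ≈ₚ p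
≈ₚ-sym p≈q = mk≈ λ k → sym (coeff-≡ p≈q k)

-- A polynomial of degree 0 may carry trailing zeros; its tail has only zero coefficients and
-- contributes nothing to the product.
coeff-constant-* : ∀ p q → HasDegree p 0 → ∀ k → coeff (p *ₚ q) k ≡ coeff p 0 * coeff q k
coeff-constant-* []      q (0≢0 , _) k = contradiction refl 0≢0
coeff-constant-* (a ∷ p) q (_ , p≈0) k = begin
  coeff ((a ∷ p) *ₚ q) k                   ≡⟨ coeff-∷* a p q k ⟩
  a * coeff q k + coeff (0ℚ ∷ (p *ₚ q)) k  ≡⟨ cong (a * coeff q k +_) (shift k) ⟩
  a * coeff q k + 0ℚ                       ≡⟨ +-identityʳ _ ⟩
  a * coeff q k                            ∎
  where
  shift : ∀ k → coeff (0ℚ ∷ (p *ₚ q)) k ≡ 0ℚ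
  shift zero    = refl
  shift (suc k) = *-zero-coeffs p q (λ j → p≈0 (suc j) (s≤s z≤n)) k

HasDegree-tail : ∀ {a p n} → HasDegree (a ∷ p) (suc n) → HasDegree p n
HasDegree-tail (lead , above) = lead , λ k n<k → above (suc k) (s≤s n<k)

coeff-*-zero : ∀ p q → coeff (p *ₚ q) 0 ≡ coeff p 0 * coeff q 0
coeff-*-zero []      q = sym (*-zeroˡ (coeff q 0))
coeff-*-zero (a ∷ p) q = trans (coeff-∷* a p q 0) (+-identityʳ _)

-- The tail of a linear polynomial has degree 0, so the convolution has just two terms.
coeff-linear-* : ∀ p q → HasDegree p 1 → ∀ k →
  coeff (p *ₚ q) (suc k) ≡ coeff p 0 * coeff q (suc k) + coeff p 1 * coeff q k
coeff-linear-* []      q (0≢0 , _) k = contradiction refl 0≢0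
coeff-linear-* (a ∷ p) q deg       k = trans (coeff-∷* a p q (suc k))
  (cong (a * coeff q (suc k) +_) (coeff-constant-* p q (HasDegree-tail deg) k))

-- Degrees

HasDegree-resp-≈ : ∀ {p q n} → p ≈ₚ q → HasDegree p n → HasDegree q n
HasDegree-resp-≈ {n = n} p≈q (lead , above) =
  (λ q≡0 → lead (trans (coeff-≡ p≈q n) q≡0)) ,
  λ k n<k → trans (sym (coeff-≡ p≈q k)) (above k n<k)

HasDegree-unique : ∀ {p m n} → HasDegree p m → HasDegree p n → m ≡ n
HasDegree-unique {m = m} {n} (leadᵐ , aboveᵐ) (leadⁿ , aboveⁿ) with <-cmp m n
... | tri< m<n _ _ = contradiction (aboveᵐ n m<n) leadⁿ
... | tri≈ _ m≡n _ = m≡n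
... | tri> _ _ n<m = contradiction (aboveⁿ m n<m) leadᵐ

-- The search runs from the last list entry down, and the first nonzero entry it meets fixes the
-- degree. Decidable equality on ℚ makes it constructive.
zero-or-degree : ∀ p → (∀ k → coeff p k ≡ 0ℚ) ⊎ ∃[ n ] HasDegree p n
zero-or-degree []      = inj₁ λ _ → refl
zero-or-degree (a ∷ p) with zero-or-degree p
... | inj₂ (n , lead , above) = inj₂ (suc n , lead , λ { (suc k) (s≤s n<k) → above k n<k })
... | inj₁ p≈0 with a ≟ 0ℚ
...   | yes a≡0 = inj₁ λ { zero → a≡0 ; (suc k) → p≈0 k }
...   | no  a≢0 = inj₂ (0 , a≢0 , λ { (suc k) _ → p≈0 k })

-- Induction on `m`. Beyond degree `n` the summand a q vanishes, so there the coefficients of the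
-- product are those of `p *ₚ q`, with `p` the tail, shifted by one place.
HasDegree-* : ∀ {p q m n} → HasDegree p m → HasDegree q n → HasDegree (p *ₚ q) (m ℕ.+ n)
HasDegree-* {p} {q} {zero} {n} degp (lead , above) =
  (λ eq → *-≢0 (proj₁ degp) lead (trans (sym (coeff-constant-* p q degp n)) eq)) ,
  λ k n<k → trans (coeff-constant-* p q degp k)
                  (trans (cong (coeff p 0 *_) (above k n<k)) (*-zeroʳ (coeff p 0)))
HasDegree-* {[]}    {q} {suc m} (0≢0 , _) _ = contradiction refl 0≢0
HasDegree-* {a ∷ p} {q} {suc m} {n} degp degq
  with lead , above ← HasDegree-* {p} {q} {m} {n} (HasDegree-tail degp) degq =
  (λ eq → lead (trans (sym (top (m ℕ.+ n) (s≤s (ℕ.m≤n+m n m)))) eq)) ,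
  λ { (suc k) (s≤s m+n<k) → trans (top k (ℕ.m≤n⇒m≤1+n (ℕ.≤-<-trans (ℕ.m≤n+m n m) m+n<k)))
                                  (above k m+n<k) }
  where
  top : ∀ k → n ℕ.< suc k → coeff ((a ∷ p) *ₚ q) (suc k) ≡ coeff (p *ₚ q) k
  top k n<1+k = begin
    coeff ((a ∷ p) *ₚ q) (suc k)               ≡⟨ coeff-∷* a p q (suc k) ⟩
    a * coeff q (suc k) + coeff (p *ₚ q) k     ≡⟨ cong (λ x → a * x + coeff (p *ₚ q) k) (proj₂ degq (suc k) n<1+k) ⟩
    a * 0ℚ + coeff (p *ₚ q) k                  ≡⟨ absorb a (coeff (p *ₚ q) k) ⟩
    coeff (p *ₚ q) k                           ∎
    where
    absorb : ∀ a x → a * 0ℚ + x ≡ x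
    absorb = solve-∀ ℚ-ring

-- Neither factor can be zero, since the product has a nonzero coefficient; hence both have degrees,
-- and these add up.
factor-degrees : ∀ {p n} x y → HasDegree p n → p ≈ₚ x *ₚ y →
  ∃[ i ] ∃[ j ] (HasDegree x i × HasDegree y j × i ℕ.+ j ≡ n)
factor-degrees {p} {n} x y degp p≈xy with zero-or-degree x | zero-or-degree y
... | inj₁ x≈0 | _ =
  contradiction (trans (coeff-≡ p≈xy n) (*-zero-coeffs x y x≈0 n)) (proj₁ degp)
... | inj₂ _ | inj₁ y≈0 =
  contradiction (trans (coeff-≡ p≈xy n) (*-zero-coeffsʳ x y y≈0 n)) (proj₁ degp)
... | inj₂ (i , degx) | inj₂ (j , degy) = i , j , degx , degy ,
  HasDegree-unique {p = p} (HasDegree-resp-≈ (≈ₚ-sym p≈xy) (HasDegree-* {x} {y} degx degy)) degp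

-- Units and irreducibles

1-degree : HasDegree (const 1ℚ) 0
1-degree = (λ ()) , λ { (suc k) _ → refl }

degree-0⇒∣1 : ∀ {p} → HasDegree p 0 → p ∣ const 1ℚ
degree-0⇒∣1 {p} (lead , above) with i , ip≡1 ← inverse lead =
  const i , mk≈ λ where
    zero    → trans (coeff-*-zero (const i) p) ip≡1
    (suc k) → begin
      coeff (const i *ₚ p) (suc k)            ≡⟨ coeff-∷* i [] p (suc k) ⟩
      i * coeff p (suc k) + 0ℚ                ≡⟨ +-identityʳ _ ⟩
      i * coeff p (suc k)                     ≡⟨ cong (i *_) (above (suc k) (s≤s z≤n)) ⟩
      i * 0ℚ                                  ≡⟨ *-zeroʳ i ⟩
      0ℚ                                      ∎

degree-suc⇒∤1 : ∀ {p n} → HasDegree p (suc n) → p ∤ const 1ℚ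
degree-suc⇒∤1 {p} degp (z , zp≈1)
  with i , j , _ , degp′ , i+j≡0 ← factor-degrees z p 1-degree (≈ₚ-sym zp≈1)
  with refl ← HasDegree-unique {p} degp degp′
  -- Degrees add up, so `i + suc n` would have to be 0.
  with () ← trans (sym i+j≡0) (ℕ.+-suc i _)

-- Of two factors whose degrees sum to 1, one is a nonzero constant and therefore a unit.
linear-irreducible : ∀ {p} → HasDegree p 1 → Irreducible p
linear-irreducible {p} degp = mkIrred (degree-suc⇒∤1 degp) split
  where
  split : ∀ {x y} → p ≈ₚ x *ₚ y → x ∣ const 1ℚ ⊎ y ∣ const 1ℚ
  split {x} {y} p≈xy with factor-degrees x y degp p≈xy
  ... | 0 , 1 , degx , _    , _ = inj₁ (degree-0⇒∣1 degx)
  ... | 1 , 0 , _    , degy , _ = inj₂ (degree-0⇒∣1 degy)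

coeff-linear-*-top : ∀ {n} p q → HasDegree p 1 → HasDegree q n →
  coeff (p *ₚ q) (suc n) ≡ coeff p 1 * coeff q n
coeff-linear-*-top {n} p q degp (_ , above) = begin
  coeff (p *ₚ q) (suc n)                                 ≡⟨ coeff-linear-* p q degp n ⟩
  coeff p 0 * coeff q (suc n) + coeff p 1 * coeff q n    ≡⟨ cong (λ x → coeff p 0 * x + coeff p 1 * coeff q n) (above (suc n) ℕ.≤-refl) ⟩
  coeff p 0 * 0ℚ + coeff p 1 * coeff q n                 ≡⟨ absorb (coeff p 0) (coeff p 1 * coeff q n) ⟩
  coeff p 1 * coeff q n                                  ∎
  where
  absorb : ∀ a x → a * 0ℚ + x ≡ x
  absorb = solve-∀ ℚ-ring

coeffs-linear² : ∀ p q → HasDegree p 1 → HasDegree q 1 →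
  coeff (p *ₚ q) 0 ≡ coeff p 0 * coeff q 0 ×
  coeff (p *ₚ q) 1 ≡ coeff p 0 * coeff q 1 + coeff p 1 * coeff q 0 ×
  coeff (p *ₚ q) 2 ≡ coeff p 1 * coeff q 1
coeffs-linear² p q degp degq =
  coeff-*-zero p q , coeff-linear-* p q degp 0 , coeff-linear-*-top p q degp degq

X²+c-degree : ∀ c → HasDegree (X ^ₚ 2 +ₚ const c) 2
X²+c-degree c = (λ ()) , λ { (suc (suc (suc k))) _ → refl ; (suc (suc zero)) (s≤s (s≤s ())) ; (suc zero) (s≤s ()) }

-- A proper splitting would have two linear factors, hence a rational root, and the square of that
-- root is -c.
X²+c-irreducible : ∀ {c} → ¬ IsSquare (- c) → Irreducible (X ^ₚ 2 +ₚ const c)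
X²+c-irreducible {c} nonsquare = mkIrred (degree-suc⇒∤1 (X²+c-degree c)) split
  where
  square : ∀ x₀ x₁ y₀ y₁ →
    - (x₀ * y₀) * (x₁ * y₁) ≡ x₀ * y₁ * (x₀ * y₁ * 1ℚ) - x₀ * y₁ * (x₀ * y₁ + x₁ * y₀)
  square = solve-∀ ℚ-ring
  simplify : ∀ c → - c ≡ - (0ℚ + c) * 1ℚ
  simplify = solve-∀ ℚ-ring
  drop : ∀ a → a * (a * 1ℚ) - a * 0ℚ ≡ a * (a * 1ℚ)
  drop = solve-∀ ℚ-ring

  -c-square : ∀ x₀ x₁ y₀ y₁ →
    0ℚ + c ≡ x₀ * y₀ → 0ℚ ≡ x₀ * y₁ + x₁ * y₀ → 1ℚ ≡ x₁ * y₁ → IsSquare (- c)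
  -c-square x₀ x₁ y₀ y₁ e₀ e₁ e₂ = s , (begin
    - c                                      ≡⟨ simplify c ⟩
    - (0ℚ + c) * 1ℚ                          ≡⟨ cong₂ (λ a b → - a * b) e₀ e₂ ⟩
    - (x₀ * y₀) * (x₁ * y₁)                  ≡⟨ square x₀ x₁ y₀ y₁ ⟩
    s * (s * 1ℚ) - s * (x₀ * y₁ + x₁ * y₀)   ≡⟨ cong (λ a → s * (s * 1ℚ) - s * a) e₁ ⟨
    s * (s * 1ℚ) - s * 0ℚ                    ≡⟨ drop s ⟩
    s * (s * 1ℚ)                             ∎)
    -- Since x₁ y₁ = 1, this is x₀ / x₁, the negative of the root of the first factor.
    where s = x₀ * y₁

  split : ∀ {x y} → X ^ₚ 2 +ₚ const c ≈ₚ x *ₚ y → x ∣ const 1ℚ ⊎ y ∣ const 1ℚ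
  split {x} {y} eq with factor-degrees x y (X²+c-degree c) eq
  ... | 0 , 2 , degx , _    , _ = inj₁ (degree-0⇒∣1 degx)
  ... | 2 , 0 , _    , degy , _ = inj₂ (degree-0⇒∣1 degy)
  ... | 1 , 1 , degx , degy , _
    with e₀ , e₁ , e₂ ← coeffs-linear² x y degx degy =
    contradiction (-c-square (coeff x 0) (coeff x 1) (coeff y 0) (coeff y 1)
      (trans (coeff-≡ eq 0) e₀) (trans (coeff-≡ eq 1) e₁) (trans (coeff-≡ eq 2) e₂)) nonsquare

linear-degree : ∀ {a b} → b ≢ 0ℚ → HasDegree (a ∷ b ∷ []) 1
linear-degree b≢0 = b≢0 , λ { (suc (suc k)) _ → refl ; (suc zero) (s≤s ()) }

-- The hypotheses say that m g = (x - σ)(x - τ).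
split-quadratic-reducible : ∀ {m σ τ} g → HasDegree g 2 → coeff g 2 * m ≡ 1ℚ →
  coeff g 1 * m ≡ - (σ + τ) → coeff g 0 * m ≡ σ * τ → ¬ Irreducible g
split-quadratic-reducible {m} {σ} {τ} g degg g₂m≡1 g₁m≡-[σ+τ] g₀m≡στ irr =
  [ degree-suc⇒∤1 (linear-degree (proj₁ degg))
  , degree-suc⇒∤1 (linear-degree {a = - τ} {1ℚ} (λ ()))
  ] (Irreducible.split-∣1 irr {x} {y} g≈xy)
  where
  g₂ = coeff g 2
  -- As `m` inverts `g₂`, g equals g₂ (X - σ)(X - τ); the constant g₂ goes into the first factor.
  x  = - (g₂ * σ) ∷ g₂ ∷ []
  y  = - τ ∷ 1ℚ ∷ []
  at₀ : ∀ g₂ σ τ → g₂ * (σ * τ) ≡ - (g₂ * σ) * - τ + 0ℚ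
  at₀ = solve-∀ ℚ-ring
  at₁ : ∀ g₂ σ τ → g₂ * - (σ + τ) ≡ - (g₂ * σ) * 1ℚ + (g₂ * - τ + 0ℚ)
  at₁ = solve-∀ ℚ-ring
  swap : ∀ g₂ a m → a * (g₂ * m) ≡ g₂ * (a * m)
  swap = solve-∀ ℚ-ring
  at : ∀ k {v w} → coeff g k * m ≡ v → g₂ * v ≡ w → coeff g k ≡ w
  at k {v} {w} gₖm≡v g₂v≡w = begin
    coeff g k                ≡⟨ *-identityʳ (coeff g k) ⟨
    coeff g k * 1ℚ           ≡⟨ cong (coeff g k *_) g₂m≡1 ⟨
    coeff g k * (g₂ * m)     ≡⟨ swap g₂ (coeff g k) m ⟩
    g₂ * (coeff g k * m)     ≡⟨ cong (g₂ *_) gₖm≡v ⟩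
    g₂ * v                   ≡⟨ g₂v≡w ⟩
    w                        ∎
  g≈xy : g ≈ₚ x *ₚ y
  g≈xy = mk≈ λ where
    0 → at 0 g₀m≡στ (at₀ g₂ σ τ)
    1 → at 1 g₁m≡-[σ+τ] (at₁ g₂ σ τ)
    2 → sym (*-identityʳ g₂)
    (suc (suc (suc k))) → proj₂ degg (3 ℕ.+ k) (s≤s (s≤s (s≤s z≤n)))

-- Quartic trinomials

-- The quartic is nested as p (q g), so the two-term formula for a linear left factor is applied
-- twice.
coeffs-quartic : ∀ p q g → HasDegree p 1 → HasDegree q 1 → HasDegree g 2 →
  let p₀ = coeff p 0 ; p₁ = coeff p 1 ; q₀ = coeff q 0 ; q₁ = coeff q 1
      g₀ = coeff g 0 ; g₁ = coeff g 1 ; g₂ = coeff g 2 ; f = p *ₚ (q *ₚ g) in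
  coeff f 0 ≡ p₀ * (q₀ * g₀) ×
  coeff f 1 ≡ p₀ * (q₀ * g₁ + q₁ * g₀) + p₁ * (q₀ * g₀) ×
  coeff f 2 ≡ p₀ * (q₀ * g₂ + q₁ * g₁) + p₁ * (q₀ * g₁ + q₁ * g₀) ×
  coeff f 3 ≡ p₀ * (q₁ * g₂) + p₁ * (q₀ * g₂ + q₁ * g₁) ×
  coeff f 4 ≡ p₁ * (q₁ * g₂)
coeffs-quartic p q g degp degq degg =
  trans (coeff-*-zero p r) (cong (coeff p 0 *_) r₀) , step 0 r₁ r₀ , step 1 r₂ r₁ , step 2 r₃ r₂ ,
  trans (coeff-linear-*-top p r degp (HasDegree-* {q} {g} degq degg)) (cong (coeff p 1 *_) r₃)
  where
  r  = q *ₚ g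
  r₀ = coeff-*-zero q g
  r₁ = coeff-linear-* q g degq 0
  r₂ = coeff-linear-* q g degq 1
  r₃ = coeff-linear-*-top q g degq degg
  step : ∀ k {a b} → coeff r (suc k) ≡ a → coeff r k ≡ b →
         coeff (p *ₚ r) (suc k) ≡ coeff p 0 * a + coeff p 1 * b
  step k a≡ b≡ = trans (coeff-linear-* p r degp k) (cong₂ (λ a b → coeff p 0 * a + coeff p 1 * b) a≡ b≡)

module _ (A B : ℚ) where

  -- The trinomial unfolds to sums with spurious zeros, which the solver removes here and in the
  -- next two lemmas. Its coefficients of x³ and x⁴ contain neither `A` nor `B` and compute to 0 and
  -- 1.
  trinomial-coeff₀ : coeff (trinomial 4 2 A B) 0 ≡ B
  trinomial-coeff₀ = simplify A B
    where
    simplify : ∀ A B → 0ℚ + (A * 0ℚ + 0ℚ) + B ≡ B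
    simplify = solve-∀ ℚ-ring

  trinomial-coeff₁ : coeff (trinomial 4 2 A B) 1 ≡ 0ℚ
  trinomial-coeff₁ = simplify A
    where
    simplify : ∀ A → 0ℚ + A * 0ℚ ≡ 0ℚ
    simplify = solve-∀ ℚ-ring

  trinomial-coeff₂ : coeff (trinomial 4 2 A B) 2 ≡ A
  trinomial-coeff₂ = simplify A
    where
    simplify : ∀ A → 0ℚ + A * 1ℚ ≡ A
    simplify = solve-∀ ℚ-ring

  trinomial-degree : HasDegree (trinomial 4 2 A B) 4
  trinomial-degree = (λ ()) , λ where
    (suc (suc (suc (suc (suc k))))) _ → refl
    1 (s≤s ())
    2 (s≤s (s≤s ()))
    3 (s≤s (s≤s (s≤s ())))
    4 (s≤s (s≤s (s≤s (s≤s ()))))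

-- Even products of two linear factors and a quadratic

x+y≡0⇒y≡-x : ∀ x {y} → x + y ≡ 0ℚ → y ≡ - x
x+y≡0⇒y≡-x x {y} x+y≡0 = begin
  y            ≡⟨ isolate x y ⟩
  x + y - x    ≡⟨ cong (_- x) x+y≡0 ⟩
  0ℚ - x       ≡⟨ drop x ⟩
  - x          ∎
  where
  isolate : ∀ x y → y ≡ x + y - x
  isolate = solve-∀ ℚ-ring
  drop : ∀ x → 0ℚ - x ≡ - x
  drop = solve-∀ ℚ-ring

-- The hypotheses compare the coefficients of x³, x², x and 1 in (x + α)(x + β)(x² + bx + c); the
-- indices in `e₃`, `e₂`, `e₁`, `e₀` are the exponents.
even-product : ∀ {α β b c A B} →
  α + β + b ≡ 0ℚ → α * β + (α + β) * b + c ≡ A →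
  α * β * b + (α + β) * c ≡ 0ℚ → α * β * c ≡ B →
  (b ≡ 0ℚ × A ≡ c - α * α × B ≡ - (c * (α * α))) ⊎
  (b ≡ - (α + β) × c ≡ α * β × A ≡ - (α * α + β * β) × B ≡ α * α * (β * β))
even-product {α} {β} {b} {c} {A} {B} e₃ e₂ e₁ e₀ = map⊎ opposite split alternatives
  where
  b≡ : b ≡ - (α + β)
  b≡ = x+y≡0⇒y≡-x (α + β) e₃

  factor : ∀ α β c → (α + β) * (- (α * β) + c) ≡ α * β * - (α + β) + (α + β) * c
  factor = solve-∀ ℚ-ring

  [α+β][c-αβ]≡0 : (α + β) * (- (α * β) + c) ≡ 0ℚ
  [α+β][c-αβ]≡0 = begin
    (α + β) * (- (α * β) + c)               ≡⟨ factor α β c ⟩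
    α * β * - (α + β) + (α + β) * c         ≡⟨ cong (λ x → α * β * x + (α + β) * c) b≡ ⟨
    α * β * b + (α + β) * c                 ≡⟨ e₁ ⟩
    0ℚ                                      ∎

  x²-coeff : ∀ α b c → α * - α + 0ℚ * b + c ≡ c - α * α
  x²-coeff = solve-∀ ℚ-ring
  1-coeff : ∀ α c → α * - α * c ≡ - (c * (α * α))
  1-coeff = solve-∀ ℚ-ring

  opposite : α + β ≡ 0ℚ → b ≡ 0ℚ × A ≡ c - α * α × B ≡ - (c * (α * α))
  opposite α+β≡0 =
    trans b≡ (cong -_ α+β≡0) ,
    trans (sym e₂) (trans (cong₂ (λ x y → α * x + y * b + c) β≡-α α+β≡0) (x²-coeff α b c)) ,
    trans (sym e₀) (trans (cong (λ x → α * x * c) β≡-α) (1-coeff α c))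
    where
    β≡-α : β ≡ - α
    β≡-α = x+y≡0⇒y≡-x α α+β≡0

  x²-coeff′ : ∀ α β → α * β + (α + β) * - (α + β) + α * β ≡ - (α * α + β * β)
  x²-coeff′ = solve-∀ ℚ-ring
  1-coeff′ : ∀ α β → α * β * (α * β) ≡ α * α * (β * β)
  1-coeff′ = solve-∀ ℚ-ring
  -‿involutive : ∀ x → - - x ≡ x
  -‿involutive = solve-∀ ℚ-ring

  split : - (α * β) + c ≡ 0ℚ →
    b ≡ - (α + β) × c ≡ α * β × A ≡ - (α * α + β * β) × B ≡ α * α * (β * β)
  split c-αβ≡0 =
    b≡ , c≡ ,
    trans (sym e₂) (trans (cong₂ (λ x y → α * β + (α + β) * x + y) b≡ c≡) (x²-coeff′ α β)) ,
    trans (sym e₀) (trans (cong (α * β *_) c≡) (1-coeff′ α β))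
    where
    c≡ : c ≡ α * β
    c≡ = trans (x+y≡0⇒y≡-x (- (α * β)) c-αβ≡0) (-‿involutive (α * β))

  alternatives : (α + β ≡ 0ℚ) ⊎ (- (α * β) + c ≡ 0ℚ)
  alternatives = x*y≡0⇒x≡0∨y≡0 {α + β} { - (α * β) + c} [α+β][c-αβ]≡0

-- m (g₀ + g₁x + g₂x²) is the monic quadratic cofactor of (x + α)(x + β), where
-- β = -α in the first alternative.
Factors : (A B g₀ g₁ g₂ : ℚ) → Set
Factors A B g₀ g₁ g₂ =
  ∃[ m ] (g₂ * m ≡ 1ℚ × ∃[ α ] (
    (g₁ * m ≡ 0ℚ × A ≡ g₀ * m - α * α × B ≡ - (g₀ * m * (α * α)))
    ⊎ ∃[ β ] (g₁ * m ≡ - (α + β) × g₀ * m ≡ α * β ×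
              A ≡ - (α * α + β * β) × B ≡ α * α * (β * β))))

-- Multiplying by suitable products of p₁, q₁, g₂, whose product is 1, makes the
-- factors p₀ + p₁x, q₀ + q₁x and g₀ + g₁x + g₂x² monic without any division.
even-product-scaled : ∀ p₀ p₁ q₀ q₁ g₀ g₁ g₂ {A B} →
  p₀ * (q₀ * g₀) ≡ B →
  p₀ * (q₀ * g₁ + q₁ * g₀) + p₁ * (q₀ * g₀) ≡ 0ℚ →
  p₀ * (q₀ * g₂ + q₁ * g₁) + p₁ * (q₀ * g₁ + q₁ * g₀) ≡ A →
  p₀ * (q₁ * g₂) + p₁ * (q₀ * g₂ + q₁ * g₁) ≡ 0ℚ →
  p₁ * (q₁ * g₂) ≡ 1ℚ →
  Factors A B g₀ g₁ g₂
even-product-scaled p₀ p₁ q₀ q₁ g₀ g₁ g₂ {A} {B} e₀ e₁ e₂ e₃ e₄ =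
  m , trans (comm g₂ p₁ q₁) e₄ , α , map₂ (β ,_) (even-product {α} {β} {g₁ * m} {c} f₃ f₂ f₁ f₀)
  where
  -- As p₁ q₁ g₂ = 1, these are m = 1 / g₂, α = p₀ / p₁ and β = q₀ / q₁.
  m = p₁ * q₁
  α = p₀ * (q₁ * g₂)
  β = q₀ * (p₁ * g₂)
  c = g₀ * m

  comm : ∀ g₂ p₁ q₁ → g₂ * (p₁ * q₁) ≡ p₁ * (q₁ * g₂)
  comm = solve-∀ ℚ-ring
  x³ : ∀ p₀ p₁ q₀ q₁ g₁ g₂ →
    p₀ * (q₁ * g₂) + q₀ * (p₁ * g₂) + g₁ * (p₁ * q₁) ≡
    p₀ * (q₁ * g₂) + p₁ * (q₀ * g₂ + q₁ * g₁)
  x³ = solve-∀ ℚ-ring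
  -- The identity must hold for all arguments, without p₁ q₁ g₂ = 1. Its last summand makes up for
  -- the mismatch in degree and disappears once that product is replaced by 1.
  x² : ∀ p₀ p₁ q₀ q₁ g₀ g₁ g₂ →
    p₀ * (q₁ * g₂) * (q₀ * (p₁ * g₂))
      + (p₀ * (q₁ * g₂) + q₀ * (p₁ * g₂)) * (g₁ * (p₁ * q₁)) + g₀ * (p₁ * q₁) ≡
    (p₀ * (q₀ * g₂ + q₁ * g₁) + p₁ * (q₀ * g₁ + q₁ * g₀)) * (p₁ * (q₁ * g₂))
      + g₀ * (p₁ * q₁) * (1ℚ - p₁ * (q₁ * g₂))
  x² = solve-∀ ℚ-ring
  x¹ : ∀ p₀ p₁ q₀ q₁ g₀ g₁ g₂ →
    p₀ * (q₁ * g₂) * (q₀ * (p₁ * g₂)) * (g₁ * (p₁ * q₁))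
      + (p₀ * (q₁ * g₂) + q₀ * (p₁ * g₂)) * (g₀ * (p₁ * q₁)) ≡
    (p₀ * (q₀ * g₁ + q₁ * g₀) + p₁ * (q₀ * g₀)) * (p₁ * (q₁ * g₂)) * (p₁ * (q₁ * g₂))
      + (p₀ * (q₁ * g₂) + q₀ * (p₁ * g₂)) * (g₀ * (p₁ * q₁)) * (1ℚ - p₁ * (q₁ * g₂))
  x¹ = solve-∀ ℚ-ring
  x⁰ : ∀ p₀ p₁ q₀ q₁ g₀ g₂ →
    p₀ * (q₁ * g₂) * (q₀ * (p₁ * g₂)) * (g₀ * (p₁ * q₁)) ≡
    p₀ * (q₀ * g₀) * (p₁ * (q₁ * g₂)) * (p₁ * (q₁ * g₂))
  x⁰ = solve-∀ ℚ-ring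
  simplify : ∀ A c → A * 1ℚ + c * (1ℚ - 1ℚ) ≡ A
  simplify = solve-∀ ℚ-ring
  vanish : ∀ c → 0ℚ * 1ℚ * 1ℚ + c * (1ℚ - 1ℚ) ≡ 0ℚ
  vanish = solve-∀ ℚ-ring
  unit : ∀ B → B * 1ℚ * 1ℚ ≡ B
  unit = solve-∀ ℚ-ring

  f₃ : α + β + g₁ * m ≡ 0ℚ
  f₃ = trans (x³ p₀ p₁ q₀ q₁ g₁ g₂) e₃
  f₂ : α * β + (α + β) * (g₁ * m) + c ≡ A
  f₂ = trans (x² p₀ p₁ q₀ q₁ g₀ g₁ g₂)
             (trans (cong₂ (λ e l → e * l + c * (1ℚ - l)) e₂ e₄) (simplify A c))
  f₁ : α * β * (g₁ * m) + (α + β) * c ≡ 0ℚ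
  f₁ = trans (x¹ p₀ p₁ q₀ q₁ g₀ g₁ g₂)
             (trans (cong₂ (λ e l → e * l * l + (α + β) * c * (1ℚ - l)) e₁ e₄) (vanish ((α + β) * c)))
  f₀ : α * β * c ≡ B
  f₀ = trans (x⁰ p₀ p₁ q₀ q₁ g₀ g₂) (trans (cong₂ (λ e l → e * l * l) e₀ e₄) (unit B))

trinomial-factors : ∀ {A B} p q g → HasDegree p 1 → HasDegree q 1 → HasDegree g 2 →
  trinomial 4 2 A B ≈ₚ p *ₚ (q *ₚ g) →
  Factors A B (coeff g 0) (coeff g 1) (coeff g 2)
trinomial-factors {A} {B} p q g degp degq degg f≈pqg
  with c₀ , c₁ , c₂ , c₃ , c₄ ← coeffs-quartic p q g degp degq degg =
  even-product-scaled (coeff p 0) (coeff p 1) (coeff q 0) (coeff q 1)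
    (coeff g 0) (coeff g 1) (coeff g 2)
    (trans (sym c₀) (trans (sym (coeff-≡ f≈pqg 0)) (trinomial-coeff₀ A B)))
    (trans (sym c₁) (trans (sym (coeff-≡ f≈pqg 1)) (trinomial-coeff₁ A B)))
    (trans (sym c₂) (trans (sym (coeff-≡ f≈pqg 2)) (trinomial-coeff₂ A B)))
    (trans (sym c₃) (sym (coeff-≡ f≈pqg 3)))
    (trans (sym c₄) (sym (coeff-≡ f≈pqg 4)))

-- The explicit factorizations

X-c-degree : ∀ c → HasDegree (X -ₚ const c) 1
X-c-degree c = linear-degree (λ ())

X+c-degree : ∀ c → HasDegree (X +ₚ const c) 1
X+c-degree c = linear-degree (λ ())

-- Up to x⁴ the coefficients are compared one by one; from x⁵ on both sides vanish, the right one
-- because of its degree.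
≈-quartic-product : ∀ {A B} p q g → HasDegree p 1 → HasDegree q 1 → HasDegree g 2 →
  let p₀ = coeff p 0 ; p₁ = coeff p 1 ; q₀ = coeff q 0 ; q₁ = coeff q 1
      g₀ = coeff g 0 ; g₁ = coeff g 1 ; g₂ = coeff g 2 in
  B ≡ p₀ * (q₀ * g₀) →
  0ℚ ≡ p₀ * (q₀ * g₁ + q₁ * g₀) + p₁ * (q₀ * g₀) →
  A ≡ p₀ * (q₀ * g₂ + q₁ * g₁) + p₁ * (q₀ * g₁ + q₁ * g₀) →
  0ℚ ≡ p₀ * (q₁ * g₂) + p₁ * (q₀ * g₂ + q₁ * g₁) →
  1ℚ ≡ p₁ * (q₁ * g₂) →
  trinomial 4 2 A B ≈ₚ p *ₚ (q *ₚ g)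
≈-quartic-product {A} {B} p q g degp degq degg e₀ e₁ e₂ e₃ e₄ = mk≈ λ where
    0 → trans (trinomial-coeff₀ A B) (trans e₀ (sym (proj₁ cs)))
    1 → trans (trinomial-coeff₁ A B) (trans e₁ (sym (proj₁ (proj₂ cs))))
    2 → trans (trinomial-coeff₂ A B) (trans e₂ (sym (proj₁ (proj₂ (proj₂ cs)))))
    3 → trans e₃ (sym (proj₁ (proj₂ (proj₂ (proj₂ cs)))))
    4 → trans e₄ (sym (proj₂ (proj₂ (proj₂ (proj₂ cs)))))
    (suc (suc (suc (suc (suc k))))) → sym (above (5 ℕ.+ k) (s≤s (s≤s (s≤s (s≤s (s≤s z≤n))))))
  where
  cs = coeffs-quartic p q g degp degq degg
  above = proj₂ (HasDegree-* {p} {q *ₚ g} degp (HasDegree-* {q} {g} degq degg))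

-- An arbitrary root `t` lets this serve both the scaled trinomial and, with `t` equal to 1, the
-- normal form.
factorization-112 : ∀ {A B} t c → ¬ IsSquare (- c) → A ≡ c - t * t → B ≡ - (c * (t * t)) →
  IrreducibleFactorization (trinomial 4 2 A B) (1 ∷ 1 ∷ 2 ∷ [])
    ((X -ₚ const t) ∷ (X +ₚ const t) ∷ (X ^ₚ 2 +ₚ const c) ∷ [])
factorization-112 {A} {B} t c nonsquare A≡ B≡ = record
  { irreducible = linear-irreducible (X-c-degree t) ∷ linear-irreducible (X+c-degree t)
                  ∷ X²+c-irreducible nonsquare ∷ []
  ; degrees     = X-c-degree t ∷ X+c-degree t ∷ X²+c-degree c ∷ []
  ; factors     = ≈ₚ-trans
      (≈-quartic-product p q g (X-c-degree t) (X+c-degree t) (X²+c-degree c)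
        (trans B≡ (x⁰ t c)) (x¹ t c) (trans A≡ (x² t c)) (x³ t) refl)
      (*ₚ-congˡ p (*ₚ-congˡ q (≈ₚ-sym (*ₚ-identityʳ g))))
  }
  where
  p = X -ₚ const t
  q = X +ₚ const t
  g = X ^ₚ 2 +ₚ const c
  -- The coefficients of p, q and g appear as they compute, with all zeros and ones.
  x⁰ : ∀ t c → - (c * (t * t)) ≡ (0ℚ + - t) * ((0ℚ + t) * (0ℚ + c))
  x⁰ = solve-∀ ℚ-ring
  x¹ : ∀ t c → 0ℚ ≡ (0ℚ + - t) * ((0ℚ + t) * 0ℚ + 1ℚ * (0ℚ + c)) + 1ℚ * ((0ℚ + t) * (0ℚ + c))
  x¹ = solve-∀ ℚ-ring
  x² : ∀ t c → c - t * t ≡ (0ℚ + - t) * ((0ℚ + t) * 1ℚ + 1ℚ * 0ℚ) + 1ℚ * ((0ℚ + t) * 0ℚ + 1ℚ * (0ℚ + c))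
  x² = solve-∀ ℚ-ring
  x³ : ∀ t → 0ℚ ≡ (0ℚ + - t) * (1ℚ * 1ℚ) + 1ℚ * ((0ℚ + t) * 1ℚ + 1ℚ * 0ℚ)
  x³ = solve-∀ ℚ-ring

-- The last two linear factors together play the part of the quadratic factor, so
-- `≈-quartic-product` applies again.
factorization-1111 : ∀ {A B} t u → A ≡ - (t * t + u * u) → B ≡ t * t * (u * u) →
  IrreducibleFactorization (trinomial 4 2 A B) (1 ∷ 1 ∷ 1 ∷ 1 ∷ [])
    ((X -ₚ const t) ∷ (X +ₚ const t) ∷ (X -ₚ const u) ∷ (X +ₚ const u) ∷ [])
factorization-1111 {A} {B} t u A≡ B≡ = record
  { irreducible = linear-irreducible (X-c-degree t) ∷ linear-irreducible (X+c-degree t)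
                  ∷ linear-irreducible (X-c-degree u) ∷ linear-irreducible (X+c-degree u) ∷ []
  ; degrees     = X-c-degree t ∷ X+c-degree t ∷ X-c-degree u ∷ X+c-degree u ∷ []
  ; factors     = ≈ₚ-trans
      (≈-quartic-product p q (r *ₚ s) (X-c-degree t) (X+c-degree t)
        (HasDegree-* {r} {s} (X-c-degree u) (X+c-degree u))
        (trans B≡ (x⁰ t u)) (x¹ t u) (trans A≡ (x² t u)) (x³ t u) refl)
      (*ₚ-congˡ p (*ₚ-congˡ q (*ₚ-congˡ r (≈ₚ-sym (*ₚ-identityʳ s)))))
  }
  where
  p = X -ₚ const t
  q = X +ₚ const t
  r = X -ₚ const u
  s = X +ₚ const u
  -- The inner sums in `u` are the coefficients of `r *ₚ s` as they compute.
  x⁰ : ∀ t u → t * t * (u * u) ≡ (0ℚ + - t) * ((0ℚ + t) * ((0ℚ + - u) * (0ℚ + u) + 0ℚ))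
  x⁰ = solve-∀ ℚ-ring
  x¹ : ∀ t u → 0ℚ ≡
    (0ℚ + - t) * ((0ℚ + t) * ((0ℚ + - u) * 1ℚ + (1ℚ * (0ℚ + u) + 0ℚ)) + 1ℚ * ((0ℚ + - u) * (0ℚ + u) + 0ℚ))
      + 1ℚ * ((0ℚ + t) * ((0ℚ + - u) * (0ℚ + u) + 0ℚ))
  x¹ = solve-∀ ℚ-ring
  x² : ∀ t u → - (t * t + u * u) ≡
    (0ℚ + - t) * ((0ℚ + t) * 1ℚ + 1ℚ * ((0ℚ + - u) * 1ℚ + (1ℚ * (0ℚ + u) + 0ℚ)))
      + 1ℚ * ((0ℚ + t) * ((0ℚ + - u) * 1ℚ + (1ℚ * (0ℚ + u) + 0ℚ)) + 1ℚ * ((0ℚ + - u) * (0ℚ + u) + 0ℚ))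
  x² = solve-∀ ℚ-ring
  x³ : ∀ t u → 0ℚ ≡
    (0ℚ + - t) * (1ℚ * 1ℚ) + 1ℚ * ((0ℚ + t) * 1ℚ + 1ℚ * ((0ℚ + - u) * 1ℚ + (1ℚ * (0ℚ + u) + 0ℚ)))
  x³ = solve-∀ ℚ-ring

-- Reducibility type (1,1,2)

scale-112 : ∀ {A B α} c → A ≢ 0ℚ → B ≢ 0ℚ → A ≡ c - α * α → B ≡ - (c * (α * α)) →
  ¬ IsSquare (- c) → ∃[ q ] (q ≢ 1ℚ × ¬ IsSquare (- q) × UpToScaling 4 2 A B (q - 1ℚ) (- q))
scale-112 {A} {B} {α} c A≢0 B≢0 A≡ B≡ nonsquare =
  q , q≢1 , -q-nonsquare , α , α≢0 ,
  trans A≡ (trans (cong (_- α * α) c≡) (x²-coeff q α)) ,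
  trans B≡ (trans (cong (λ x → - (x * (α * α))) c≡) (1-coeff q α))
  where
  vanish : ∀ c → - (c * (0ℚ * 0ℚ)) ≡ 0ℚ
  vanish = solve-∀ ℚ-ring
  -- The constant term is a multiple of α², so `B≢0` makes α a legitimate scaling factor.
  α≢0 : α ≢ 0ℚ
  α≢0 α≡0 = B≢0 (trans B≡ (trans (cong (λ x → - (c * (x * x))) α≡0) (vanish c)))

  -- Dividing all roots by α turns c into c / α², which becomes the parameter `q`.
  c/α² : ∃[ q ] c ≡ q * (α * α)
  c/α² = quotient (*-≢0 α≢0 α≢0) c
  q  = proj₁ c/α²
  c≡ = proj₂ c/α²

  cancel : ∀ x → 1ℚ * x - x ≡ 0ℚ
  cancel = solve-∀ ℚ-ring
  -- For q = 1 the coefficient c - α² would be 0, contrary to `A≢0`.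
  q≢1 : q ≢ 1ℚ
  q≢1 q≡1 = A≢0 (trans A≡ (trans (cong (_- α * α) (trans c≡ (cong (_* (α * α)) q≡1))) (cancel (α * α))))

  assoc : ∀ q α → - (q * (α * α)) ≡ - q * (α * α)
  assoc = solve-∀ ℚ-ring
  distrib : ∀ s α → s * (s * 1ℚ) * (α * α) ≡ s * α * (s * α * 1ℚ)
  distrib = solve-∀ ℚ-ring
  -- A square root of -q, multiplied by α, would be a square root of -c.
  -q-nonsquare : ¬ IsSquare (- q)
  -q-nonsquare (s , -q≡s²) = nonsquare (s * α , (begin
    - c                          ≡⟨ cong -_ c≡ ⟩
    - (q * (α * α))              ≡⟨ assoc q α ⟩
    - q * (α * α)                ≡⟨ cong (_* (α * α)) -q≡s² ⟩
    s * (s * 1ℚ) * (α * α)       ≡⟨ distrib s α ⟩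
    s * α * (s * α * 1ℚ)         ∎))

  x²-coeff : ∀ q α → q * (α * α) - α * α ≡ (q - 1ℚ) * (α * (α * 1ℚ))
  x²-coeff = solve-∀ ℚ-ring
  1-coeff : ∀ q α → - (q * (α * α) * (α * α)) ≡ - q * (α * (α * (α * (α * 1ℚ))))
  1-coeff = solve-∀ ℚ-ring

type-112⇒scaled : ∀ {A B} → A ≢ 0ℚ → B ≢ 0ℚ →
  HasReducibilityType (trinomial 4 2 A B) (1 ∷ 1 ∷ 2 ∷ []) →
  ∃[ q ] (q ≢ 1ℚ × ¬ IsSquare (- q) × UpToScaling 4 2 A B (q - 1ℚ) (- q))
type-112⇒scaled {A} {B} A≢0 B≢0 record { factorization = p ∷ q ∷ g ∷ [] , record
  { irreducible = _ ∷ _ ∷ irr ∷ [] ; degrees = degp ∷ degq ∷ degg ∷ [] ; factors = f≈pqg } } =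
  conclude (trinomial-factors p q g degp degq degg
              (≈ₚ-trans f≈pqg (*ₚ-congˡ p (*ₚ-congˡ q (*ₚ-identityʳ g)))))
  where
  sum : ∀ s → 0ℚ ≡ - (s + - s)
  sum = solve-∀ ℚ-ring
  -‿involutive : ∀ x → x ≡ - - x
  -‿involutive = solve-∀ ℚ-ring
  product : ∀ s → - (s * (s * 1ℚ)) ≡ s * - s
  product = solve-∀ ℚ-ring

  conclude : Factors A B (coeff g 0) (coeff g 1) (coeff g 2) →
    ∃[ q ] (q ≢ 1ℚ × ¬ IsSquare (- q) × UpToScaling 4 2 A B (q - 1ℚ) (- q))
  -- Here the cofactor has the roots α and β, against the irreducibility of `g`.
  conclude (m , g₂m≡1 , α , inj₂ (β , g₁m≡ , g₀m≡ , _)) =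
    contradiction irr (split-quadratic-reducible {m} {α} {β} g degg g₂m≡1 g₁m≡ g₀m≡)
  conclude (m , g₂m≡1 , α , inj₁ (g₁m≡0 , A≡ , B≡)) =
    scale-112 {A} {B} {α} c A≢0 B≢0 A≡ B≡ nonsquare
    where
    c = coeff g 0 * m
    nonsquare : ¬ IsSquare (- c)
    -- If -c = s², the cofactor x² + c has the roots s and -s.
    nonsquare (s , -c≡s²) =
      split-quadratic-reducible {m} {s} { - s} g degg g₂m≡1 (trans g₁m≡0 (sum s)) c≡-s² irr
      where
      c≡-s² : c ≡ s * - s
      c≡-s² = begin
        c                    ≡⟨ -‿involutive c ⟩
        - - c                ≡⟨ cong -_ -c≡s² ⟩
        - (s * (s * 1ℚ))     ≡⟨ product s ⟩
        s * - s              ∎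

scaled⇒type-112 : ∀ {A B} →
  ∃[ q ] (q ≢ 1ℚ × ¬ IsSquare (- q) × UpToScaling 4 2 A B (q - 1ℚ) (- q)) →
  HasReducibilityType (trinomial 4 2 A B) (1 ∷ 1 ∷ 2 ∷ [])
scaled⇒type-112 {A} {B} (q , _ , nonsquare , t , t≢0 , A≡ , B≡) = record
  { monic         = 4 , trinomial-degree A B , refl
  ; nondecreasing = ℕ.≤-refl ∷ s≤s z≤n ∷ [-]
  -- Scaling by t moves the roots 1 and -1 to t and -t, and the quadratic factor becomes x² + q t².
  ; factorization = _ , factorization-112 t (q * (t * t)) -qt²-nonsquare
                          (trans A≡ (x²-coeff q t)) (trans B≡ (1-coeff q t))
  }
  where
  x²-coeff : ∀ q t → (q - 1ℚ) * (t * (t * 1ℚ)) ≡ q * (t * t) - t * t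
  x²-coeff = solve-∀ ℚ-ring
  1-coeff : ∀ q t → - q * (t * (t * (t * (t * 1ℚ)))) ≡ - (q * (t * t) * (t * t))
  1-coeff = solve-∀ ℚ-ring

  assoc : ∀ q t → - q * (t * t) ≡ - (q * (t * t))
  assoc = solve-∀ ℚ-ring
  square : ∀ w t → w * t * (w * t * 1ℚ) ≡ w * (w * 1ℚ) * (t * t)
  square = solve-∀ ℚ-ring
  -qt²-nonsquare : ¬ IsSquare (- (q * (t * t)))
  -- A square root of -(q t²), divided by t, would be a square root of -q.
  -qt²-nonsquare (s , -qt²≡s²) = nonsquare (w , *-cancelʳ (*-≢0 t≢0 t≢0) -qt²≡w²t²)
    where
    s/t : ∃[ w ] s ≡ w * t
    s/t = quotient t≢0 s
    w = proj₁ s/t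
    -qt²≡w²t² : - q * (t * t) ≡ w * (w * 1ℚ) * (t * t)
    -qt²≡w²t² = begin
      - q * (t * t)               ≡⟨ assoc q t ⟩
      - (q * (t * t))             ≡⟨ -qt²≡s² ⟩
      s * (s * 1ℚ)                ≡⟨ cong (λ x → x * (x * 1ℚ)) (proj₂ s/t) ⟩
      w * t * (w * t * 1ℚ)        ≡⟨ square w t ⟩
      w * (w * 1ℚ) * (t * t)      ∎

-- Reducibility type (1,1,1,1)

scale-1111 : ∀ {A B α β} → B ≢ 0ℚ → A ≡ - (α * α + β * β) → B ≡ α * α * (β * β) →
  ∃[ u ] (u ≢ 0ℚ × UpToScaling 4 2 A B (- (u ^ 2) - 1ℚ) (u ^ 2))
scale-1111 {A} {B} {α} {β} B≢0 A≡ B≡ =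
  u , u≢0 , α , α≢0 ,
  trans A≡ (trans (cong (λ x → - (α * α + x * x)) β≡) (x²-coeff α u)) ,
  trans B≡ (trans (cong (λ x → α * α * (x * x)) β≡) (1-coeff α u))
  where
  vanishˡ : ∀ x → 0ℚ * 0ℚ * x ≡ 0ℚ
  vanishˡ = solve-∀ ℚ-ring
  α≢0 : α ≢ 0ℚ
  α≢0 α≡0 = B≢0 (trans B≡ (trans (cong (λ x → x * x * (β * β)) α≡0) (vanishˡ (β * β))))

  -- The roots are ±α and ±β; dividing them by α gives ±1 and ±u.
  β/α : ∃[ u ] β ≡ u * α
  β/α = quotient α≢0 β
  u  = proj₁ β/α
  β≡ = proj₂ β/α

  x²-coeff : ∀ α u → - (α * α + u * α * (u * α)) ≡ (- (u * (u * 1ℚ)) - 1ℚ) * (α * (α * 1ℚ))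
  x²-coeff = solve-∀ ℚ-ring
  1-coeff : ∀ α u → α * α * (u * α * (u * α)) ≡ u * (u * 1ℚ) * (α * (α * (α * (α * 1ℚ))))
  1-coeff = solve-∀ ℚ-ring

  vanishʳ : ∀ α x → x * x * (0ℚ * α * (0ℚ * α)) ≡ 0ℚ
  vanishʳ = solve-∀ ℚ-ring
  u≢0 : u ≢ 0ℚ
  u≢0 u≡0 = B≢0 (trans B≡ (trans
    (cong (λ x → α * α * (x * x)) (trans β≡ (cong (_* α) u≡0))) (vanishʳ α α)))

-- The hypotheses say that m (r₀ + r₁x)(s₀ + s₁x) is x² + c.
opposite-roots : ∀ {m} r₀ r₁ s₀ s₁ →
  r₁ * s₁ * m ≡ 1ℚ → (r₀ * s₁ + r₁ * s₀) * m ≡ 0ℚ → ∃[ γ ] r₀ * s₀ * m ≡ - (γ * γ)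
opposite-roots {m} r₀ r₁ s₀ s₁ e₂ e₁ = r₀ * s₁ * m , (begin
  c                                                            ≡⟨ *-identityʳ c ⟨
  c * 1ℚ                                                       ≡⟨ cong (c *_) e₂ ⟨
  c * (r₁ * s₁ * m)                                            ≡⟨ expand m r₀ r₁ s₀ s₁ ⟩
  γ * ((r₀ * s₁ + r₁ * s₀) * m) - γ * γ                        ≡⟨ cong (λ x → γ * x - γ * γ) e₁ ⟩
  γ * 0ℚ - γ * γ                                               ≡⟨ drop γ ⟩
  - (γ * γ)                                                    ∎)
  where
  c = r₀ * s₀ * m
  -- As r₁ s₁ m = 1, this is r₀ / r₁, the negative of the root of r₀ + r₁ x.
  γ = r₀ * s₁ * m
  expand : ∀ m r₀ r₁ s₀ s₁ → r₀ * s₀ * m * (r₁ * s₁ * m) ≡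
    r₀ * s₁ * m * ((r₀ * s₁ + r₁ * s₀) * m) - r₀ * s₁ * m * (r₀ * s₁ * m)
  expand = solve-∀ ℚ-ring
  drop : ∀ γ → γ * 0ℚ - γ * γ ≡ - (γ * γ)
  drop = solve-∀ ℚ-ring

-- In the second alternative of `Factors`, A and B have this form already. In the first the monic
-- cofactor is x² + c and splits, so its roots are opposite and c = -γ².
two-linear-cofactors : ∀ {A B} r₀ r₁ s₀ s₁ →
  Factors A B (r₀ * s₀) (r₀ * s₁ + r₁ * s₀) (r₁ * s₁) →
  ∃[ α ] ∃[ γ ] (A ≡ - (α * α + γ * γ) × B ≡ α * α * (γ * γ))
two-linear-cofactors _ _ _ _ (m , _ , α , inj₂ (β , _ , _ , A≡ , B≡)) = α , β , A≡ , B≡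
two-linear-cofactors {A} {B} r₀ r₁ s₀ s₁ (m , g₂m≡1 , α , inj₁ (g₁m≡0 , A≡ , B≡)) =
  α , γ , A≡′ , B≡′
  where
  roots : ∃[ γ ] r₀ * s₀ * m ≡ - (γ * γ)
  roots = opposite-roots {m} r₀ r₁ s₀ s₁ g₂m≡1 g₁m≡0
  γ = proj₁ roots
  x²-coeff : ∀ α γ → - (γ * γ) - α * α ≡ - (α * α + γ * γ)
  x²-coeff = solve-∀ ℚ-ring
  1-coeff : ∀ α γ → - (- (γ * γ) * (α * α)) ≡ α * α * (γ * γ)
  1-coeff = solve-∀ ℚ-ring
  A≡′ : A ≡ - (α * α + γ * γ)
  A≡′ = trans A≡ (trans (cong (_- α * α) (proj₂ roots)) (x²-coeff α γ))
  B≡′ : B ≡ α * α * (γ * γ)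
  B≡′ = trans B≡ (trans (cong (λ x → - (x * (α * α))) (proj₂ roots)) (1-coeff α γ))

-- With the last two linear factors grouped into one quadratic, the analysis of a quadratic cofactor
-- covers this type too.
type-1111⇒scaled : ∀ {A B} → B ≢ 0ℚ →
  HasReducibilityType (trinomial 4 2 A B) (1 ∷ 1 ∷ 1 ∷ 1 ∷ []) →
  ∃[ u ] (u ≢ 0ℚ × UpToScaling 4 2 A B (- (u ^ 2) - 1ℚ) (u ^ 2))
type-1111⇒scaled {A} {B} B≢0 record { factorization = p ∷ q ∷ r ∷ s ∷ [] , record
  { degrees = degp ∷ degq ∷ degr ∷ degs ∷ [] ; factors = f≈pqrs } } =
  scale-1111 {A} {B} {proj₁ squares} {proj₁ (proj₂ squares)} B≢0
    (proj₁ (proj₂ (proj₂ squares))) (proj₂ (proj₂ (proj₂ squares)))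
  where
  f≈pq[rs] : trinomial 4 2 A B ≈ₚ p *ₚ (q *ₚ (r *ₚ s))
  f≈pq[rs] = ≈ₚ-trans f≈pqrs (*ₚ-congˡ p (*ₚ-congˡ q (*ₚ-congˡ r (*ₚ-identityʳ s))))

  factors : Factors A B (coeff (r *ₚ s) 0) (coeff (r *ₚ s) 1) (coeff (r *ₚ s) 2)
  factors = trinomial-factors p q (r *ₚ s) degp degq (HasDegree-* {r} {s} degr degs) f≈pq[rs]

  r₀ = coeff r 0
  r₁ = coeff r 1
  s₀ = coeff s 0
  s₁ = coeff s 1
  cs = coeffs-linear² r s degr degs

  -- Writing the coefficients of `r *ₚ s` in terms of those of `r` and `s` makes the splitting of
  -- the cofactor visible.
  factors′ : Factors A B (r₀ * s₀) (r₀ * s₁ + r₁ * s₀) (r₁ * s₁)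
  factors′ = subst (λ g₂ → Factors A B (r₀ * s₀) (r₀ * s₁ + r₁ * s₀) g₂) (proj₂ (proj₂ cs))
    (subst (λ g₁ → Factors A B (r₀ * s₀) g₁ (coeff (r *ₚ s) 2)) (proj₁ (proj₂ cs))
      (subst (λ g₀ → Factors A B g₀ (coeff (r *ₚ s) 1) (coeff (r *ₚ s) 2)) (proj₁ cs) factors))

  squares : ∃[ α ] ∃[ γ ] (A ≡ - (α * α + γ * γ) × B ≡ α * α * (γ * γ))
  squares = two-linear-cofactors r₀ r₁ s₀ s₁ factors′

scaled⇒type-1111 : ∀ {A B} →
  ∃[ u ] (u ≢ 0ℚ × UpToScaling 4 2 A B (- (u ^ 2) - 1ℚ) (u ^ 2)) →
  HasReducibilityType (trinomial 4 2 A B) (1 ∷ 1 ∷ 1 ∷ 1 ∷ [])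
scaled⇒type-1111 {A} {B} (u , _ , t , _ , A≡ , B≡) = record
  { monic         = 4 , trinomial-degree A B , refl
  ; nondecreasing = ℕ.≤-refl ∷ ℕ.≤-refl ∷ ℕ.≤-refl ∷ [-]
  ; factorization = _ , factorization-1111 t (u * t)
                          (trans A≡ (x²-coeff u t)) (trans B≡ (1-coeff u t))
  }
  where
  x²-coeff : ∀ u t → (- (u * (u * 1ℚ)) - 1ℚ) * (t * (t * 1ℚ)) ≡ - (t * t + u * t * (u * t))
  x²-coeff = solve-∀ ℚ-ring
  1-coeff : ∀ u t → u * (u * 1ℚ) * (t * (t * (t * (t * 1ℚ)))) ≡ t * t * (u * t * (u * t))
  1-coeff = solve-∀ ℚ-ring

theorem2p2 : (A B : ℚ) → A * B ≢ 0ℚ →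
    ( ( HasReducibilityType (trinomial 4 2 A B) (1 ∷ 1 ∷ 2 ∷ [])
    ⇔ (∃[ q ] (q ≢ 1ℚ × ¬ IsSquare (- q) × UpToScaling 4 2 A B (q - 1ℚ) (- q))) )
    × ( ∀ q → q ≢ 1ℚ → ¬ IsSquare (- q) → UpToScaling 4 2 A B (q - 1ℚ) (- q) →
    IrreducibleFactorization (trinomial 4 2 (q - 1ℚ) (- q)) (1 ∷ 1 ∷ 2 ∷ [])
    ((X -ₚ const 1ℚ) ∷ (X +ₚ const 1ℚ) ∷ (X ^ₚ 2 +ₚ const q) ∷ []) ) )
    × ( ( HasReducibilityType (trinomial 4 2 A B) (1 ∷ 1 ∷ 1 ∷ 1 ∷ [])
    ⇔ (∃[ u ] (u ≢ 0ℚ × UpToScaling 4 2 A B (- (u ^ 2) - 1ℚ) (u ^ 2))) )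
    × ( ∀ u → u ≢ 0ℚ → UpToScaling 4 2 A B (- (u ^ 2) - 1ℚ) (u ^ 2) →
    IrreducibleFactorization (trinomial 4 2 (- (u ^ 2) - 1ℚ) (u ^ 2)) (1 ∷ 1 ∷ 1 ∷ 1 ∷ [])
    ((X -ₚ const 1ℚ) ∷ (X +ₚ const 1ℚ) ∷ (X -ₚ const u) ∷ (X +ₚ const u) ∷ []) ) )
theorem2p2 A B AB≢0 =
  ( mk⇔ (type-112⇒scaled {A} {B} A≢0 B≢0) scaled⇒type-112
  -- The normal form is the unscaled case, with the root `t` equal to 1.
  , λ q _ nonsquare _ → factorization-112 1ℚ q nonsquare refl (cong -_ (sym (*-identityʳ q))) ) ,
  ( mk⇔ (type-1111⇒scaled B≢0) scaled⇒type-1111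
  , λ u _ _ → factorization-1111 1ℚ u (x²-coeff u) (1-coeff u) )
  where
  A≢0 : A ≢ 0ℚ
  A≢0 A≡0 = AB≢0 (trans (cong (_* B) A≡0) (*-zeroˡ B))
  B≢0 : B ≢ 0ℚ
  B≢0 B≡0 = AB≢0 (trans (cong (A *_) B≡0) (*-zeroʳ A))
  x²-coeff : ∀ u → - (u * (u * 1ℚ)) - 1ℚ ≡ - (1ℚ * 1ℚ + u * u)
  x²-coeff = solve-∀ ℚ-ring
  1-coeff : ∀ u → u * (u * 1ℚ) ≡ 1ℚ * 1ℚ * (u * u)
  1-coeff = solve-∀ ℚ-ring
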